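{- For every rational number $n$, define $$\begin{aligned} x_1&=16n^4-64n^3-13n^2-4n+1,\\ x_2&=32n^5-16n^4+30n^3+13n^2-2n-1,\\ x_3&=-32n^5+16n^4+26n^3-15n^2-2n-1,\\ x_4&=-32n^5-32n^4+26n^3-32n^2-2n,\\ y_1&=-32n^5+32n^4+26n^3+32n^2-2n,\\ y_2&=-32n^5-16n^4+26n^3+15n^2-2n+1,\\ y_3&=16n^4+64n^3-13n^2+4n+1,\\ y_4&=32n^5+16n^4+30n^3-13n^2-2n+1, \end{aligned}$$ and $x_5=-x_4$, $x_6=-x_3$, $x_7=-x_2$, $x_8=-x_1$, $y_5=-y_4$, $y_6=-y_3$, $y_7=-y_2$, $y_8=-y_1$. Then $$\sum_{i=1}^8x_i^r=\sum_{i=1}^8y_i^r\qquad\text{for } r=1,2,3,4,5,6,7.$$ Moreover, as a parametric solution this is nontrivial: in $\mathbb{Q}[n]$ the multisets $\{x_1,\dots,x_8\}$ and $\{y_1,\dots,y_8\}$ are distinct.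
   Context: An ideal solution of the Tarry-Escott problem of degree $k$ consists of two distinct multisets $\{x_1,\dots,x_{k+1}\}$, $\{y_1,\dots,y_{k+1}\}$ with $\sum x_i^r=\sum y_i^r$ for $r=1,\dots,k$. -}

module Defs where

open import Algebra.Bundles using (RawRing)
open import Data.List.Base as List using (List; []; _∷_)
open import Data.Nat.Base using (ℕ; zero; suc)
open import Data.Rational.Base as ℚ using (ℚ; 0ℚ; 1ℚ)
open import Data.Vec.Functional as Vector using (Vector)
open import Level using (0ℓ)
open import Relation.Binary.Bundles using (Setoid)
open import Relation.Binary.PropositionalEquality using (_≡_; refl; sym; trans)

import Algebra.Definitions.RawSemiring as RawSemiringDefs
import Data.List.Relation.Binary.Permutation.Setoid as Permutation

-- The formulas are written once, over an arbitrary raw ring, so that the same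
-- expressions can be read both at a rational number n and at the indeterminate
-- of ℚ[n].  Here k × a is the k-fold sum a + ⋯ + a.

module Formulas {c ℓ} (R : RawRing c ℓ) where

  open RawRing R
  open RawSemiringDefs rawSemiring using (_×_; _^_; sum)

  infixl 6 _-_
  _-_ : Carrier → Carrier → Carrier
  a - b = a + (- b)

  x₁ x₂ x₃ x₄ y₁ y₂ y₃ y₄ : Carrier → Carrier

  x₁ n = 16 × n ^ 4 - 64 × n ^ 3 - 13 × n ^ 2 - 4 × n + 1#
  x₂ n = 32 × n ^ 5 - 16 × n ^ 4 + 30 × n ^ 3 + 13 × n ^ 2 - 2 × n - 1#
  x₃ n = - (32 × n ^ 5) + 16 × n ^ 4 + 26 × n ^ 3 - 15 × n ^ 2 - 2 × n - 1#
  x₄ n = - (32 × n ^ 5) - 32 × n ^ 4 + 26 × n ^ 3 - 32 × n ^ 2 - 2 × n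

  y₁ n = - (32 × n ^ 5) + 32 × n ^ 4 + 26 × n ^ 3 + 32 × n ^ 2 - 2 × n
  y₂ n = - (32 × n ^ 5) - 16 × n ^ 4 + 26 × n ^ 3 + 15 × n ^ 2 - 2 × n + 1#
  y₃ n = 16 × n ^ 4 + 64 × n ^ 3 - 13 × n ^ 2 + 4 × n + 1#
  y₄ n = 32 × n ^ 5 + 16 × n ^ 4 + 30 × n ^ 3 - 13 × n ^ 2 - 2 × n + 1#

  x y : Carrier → Vector Carrier 8
  x n = Vector.fromList
    (x₁ n ∷ x₂ n ∷ x₃ n ∷ x₄ n ∷ - x₄ n ∷ - x₃ n ∷ - x₂ n ∷ - x₁ n ∷ [])
  y n = Vector.fromList
    (y₁ n ∷ y₂ n ∷ y₃ n ∷ y₄ n ∷ - y₄ n ∷ - y₃ n ∷ - y₂ n ∷ - y₁ n ∷ [])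

  powerSum : ∀ {m} → ℕ → Vector Carrier m → Carrier
  powerSum r v = sum (λ i → v i ^ r)

-- a₀ ∷ a₁ ∷ ⋯ ∷ a_d ∷ [] represents a₀ + a₁ X + ⋯ + a_d X^d.  Trailing zeros
-- are allowed, so polynomials are compared by _≈ᴾ_ and not by _≡_.

Poly : Set
Poly = List ℚ

coeff : Poly → ℕ → ℚ
coeff []      _       = 0ℚ
coeff (a ∷ _) zero    = a
coeff (_ ∷ p) (suc k) = coeff p k

infix 4 _≈ᴾ_
_≈ᴾ_ : Poly → Poly → Set
p ≈ᴾ q = ∀ k → coeff p k ≡ coeff q k

infixl 6 _+ᴾ_
_+ᴾ_ : Poly → Poly → Poly
[]      +ᴾ q       = q
(a ∷ p) +ᴾ []      = a ∷ p
(a ∷ p) +ᴾ (b ∷ q) = (a ℚ.+ b) ∷ (p +ᴾ q)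

-- (a + X p) q = a q + X (p q)
infixl 7 _*ᴾ_
_*ᴾ_ : Poly → Poly → Poly
[]      *ᴾ q = []
(a ∷ p) *ᴾ q = List.map (a ℚ.*_) q +ᴾ (0ℚ ∷ (p *ᴾ q))

-ᴾ_ : Poly → Poly
-ᴾ p = List.map ℚ.-_ p

X : Poly
X = 0ℚ ∷ 1ℚ ∷ []

ℚ[n]-rawRing : RawRing 0ℓ 0ℓ
ℚ[n]-rawRing = record
  { Carrier = Poly
  ; _≈_     = _≈ᴾ_
  ; _+_     = _+ᴾ_
  ; _*_     = _*ᴾ_
  ; -_      = -ᴾ_
  ; 0#      = []
  ; 1#      = 1ℚ ∷ []
  }

ℚ[n]-setoid : Setoid 0ℓ 0ℓ
ℚ[n]-setoid = record
  { Carrier       = Poly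
  ; _≈_           = _≈ᴾ_
  ; isEquivalence = record
    { refl  = λ _ → refl
    ; sym   = λ p≈q k → sym (p≈q k)
    ; trans = λ p≈q q≈r k → trans (p≈q k) (q≈r k)
    }
  }

module AtRational = Formulas ℚ.+-*-rawRing
module AtIndeterminate = Formulas ℚ[n]-rawRing

-- Two families list the same multiset when they are permutations of each
-- other, up to equality of polynomials.
infix 4 _≈ᴹ_
_≈ᴹ_ : ∀ {m} → Vector Poly m → Vector Poly m → Set
u ≈ᴹ v = Permutation._↭_ ℚ[n]-setoid (Vector.toList u) (Vector.toList v)

{-# OPTIONS --safe #-}

-- The seven power-sum identities are polynomial identities in n with integer
-- coefficients, so they hold in every commutative ring; they are checked on
-- Horner normal forms over ℤ.  The multisets differ in ℚ[n] because x₁, unlike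
-- every yᵢ, has coefficient 16 at n⁴ together with coefficient −64 at n³.
module Submission where

open import Defs
open import Data.Nat.Base as ℕ using (ℕ; _≤_; zero; suc; s≤s)
open import Data.Product.Base using (_×_; _,_)
open import Data.Rational.Base as ℚ using (ℚ)
open import Relation.Binary.PropositionalEquality
  using (_≡_; refl; sym; trans; cong)
open import Relation.Nullary.Negation using (¬_)

open import Algebra.Bundles using (CommutativeRing; RawRing)
open import Algebra.Solver.Ring.AlmostCommutativeRing
  using (fromCommutativeRing; _-Raw-AlmostCommutative⟶_)
open import Data.Fin.Base using (zero)
open import Data.Integer.Base as ℤ using (ℤ; +_; -[1+_])
import Data.Integer.Properties as ℤ
open import Data.List.Relation.Unary.Any using (here; any?)
open import Data.List.Relation.Binary.Permutation.Setoid.Properties ℚ[n]-setoid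
  using (Any-resp-↭)
import Data.Maybe.Base as Maybe
import Data.Rational.Properties as ℚ
open import Data.Vec.Base using (_∷_; [])
import Data.Vec.Functional as Vector
open import Relation.Binary.Definitions using (_Respects_)
open import Relation.Nullary.Decidable
  using (_×-dec_; dec⇒maybe; from-no)
open import Relation.Unary using (Decidable)

-- Coefficients are kept in ℤ rather than in `R`, so that normal forms compute on closed numerals
-- while `R` stays abstract.
module IntegerSolver {c ℓ} (R : CommutativeRing c ℓ) where

  private module R = CommutativeRing R
  open R using (Carrier; _≈_; _+_; _*_; -_; _-_; 0#; 1#)
  open import Algebra.Properties.Semiring.Mult.TCOptimised R.semiring
    using (×-homo-+; ×1-homo-*; 1+×) renaming (_×_ to _×′_)
  open import Algebra.Properties.Ring R.ring
    using (-‿distribˡ-*; -‿distribʳ-*)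
  open import Algebra.Properties.AbelianGroup R.+-abelianGroup
    using (ε⁻¹≈ε; ⁻¹-involutive; ⁻¹-∙-comm)
  open import Algebra.Properties.CommutativeSemigroup
    R.+-commutativeSemigroup using (interchange)
  open import Relation.Binary.Reasoning.Setoid R.setoid

  -- The canonical homomorphism from ℤ. With the optimised multiple, `1 ×′ 1#` reduces to `1#`, so
  -- the solver's constant 1 evaluates to `1#` definitionally.
  fromℤ : ℤ → Carrier
  fromℤ (+ n)    = n ×′ 1#
  fromℤ -[1+ n ] = - (suc n ×′ 1#)

  fromℤ-cong : ∀ {i j} → i ≡ j → fromℤ i ≈ fromℤ j
  fromℤ-cong i≡j = R.reflexive (cong fromℤ i≡j)

  fromℤ-neg : ∀ i → fromℤ (ℤ.- i) ≈ - fromℤ i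
  fromℤ-neg (+ zero)  = R.sym ε⁻¹≈ε
  fromℤ-neg (+ suc n) = R.refl
  fromℤ-neg -[1+ n ]  = R.sym (⁻¹-involutive _)

  fromℤ-⊖ : ∀ m n → fromℤ (m ℤ.⊖ n) ≈ m ×′ 1# - n ×′ 1#
  fromℤ-⊖ m zero = begin
    m ×′ 1#          ≈⟨ R.+-identityʳ _ ⟨
    m ×′ 1# + 0#     ≈⟨ R.+-congˡ ε⁻¹≈ε ⟨
    m ×′ 1# - 0#     ∎
  fromℤ-⊖ zero (suc n) = R.sym (R.+-identityˡ _)
  fromℤ-⊖ (suc m) (suc n) = begin
    fromℤ (suc m ℤ.⊖ suc n)              ≈⟨ fromℤ-cong (ℤ.[1+m]⊖[1+n]≡m⊖n m n) ⟩
    fromℤ (m ℤ.⊖ n)                      ≈⟨ fromℤ-⊖ m n ⟩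
    m ×′ 1# - n ×′ 1#                    ≈⟨ R.+-identityˡ _ ⟨
    -- Writing 0 as `1# - 1#` provides the unit that `m` and `n` each need to become successors.
    0# + (m ×′ 1# - n ×′ 1#)             ≈⟨ R.+-congʳ (R.-‿inverseʳ 1#) ⟨
    (1# - 1#) + (m ×′ 1# - n ×′ 1#)      ≈⟨ interchange _ _ _ _ ⟩
    (1# + m ×′ 1#) + (- 1# - n ×′ 1#)    ≈⟨ R.+-congˡ (⁻¹-∙-comm _ _) ⟩
    (1# + m ×′ 1#) - (1# + n ×′ 1#)      ≈⟨ R.+-cong (1+× m 1#) (R.-‿cong (1+× n 1#)) ⟨
    suc m ×′ 1# - suc n ×′ 1#            ∎

  fromℤ-+ : ∀ i j → fromℤ (i ℤ.+ j) ≈ fromℤ i + fromℤ j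
  fromℤ-+ (+ m)    (+ n)    = ×-homo-+ 1# m n
  fromℤ-+ (+ m)    -[1+ n ] = fromℤ-⊖ m (suc n)
  fromℤ-+ -[1+ m ] (+ n)    = R.trans (fromℤ-⊖ n (suc m)) (R.+-comm _ _)
  fromℤ-+ -[1+ m ] -[1+ n ] = begin
    fromℤ (-[1+ m ] ℤ.+ -[1+ n ])              ≈⟨ fromℤ-cong (ℤ.neg-distrib-+ (+ suc m) (+ suc n)) ⟨
    fromℤ (ℤ.- (+ (suc m ℕ.+ suc n)))          ≈⟨ fromℤ-neg (+ (suc m ℕ.+ suc n)) ⟩
    - ((suc m ℕ.+ suc n) ×′ 1#)                ≈⟨ R.-‿cong (×-homo-+ 1# (suc m) (suc n)) ⟩
    - (suc m ×′ 1# + suc n ×′ 1#)              ≈⟨ ⁻¹-∙-comm _ _ ⟨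
    - (suc m ×′ 1#) - suc n ×′ 1#              ∎

  fromℤ-+* : ∀ m j → fromℤ (+ m ℤ.* j) ≈ m ×′ 1# * fromℤ j
  fromℤ-+* m (+ n) = begin
    fromℤ (+ m ℤ.* + n)      ≈⟨ fromℤ-cong (ℤ.pos-* m n) ⟨
    (m ℕ.* n) ×′ 1#          ≈⟨ ×1-homo-* m n ⟩
    m ×′ 1# * (n ×′ 1#)      ∎
  fromℤ-+* m -[1+ n ] = begin
    fromℤ (+ m ℤ.* -[1+ n ])          ≈⟨ fromℤ-cong (ℤ.neg-distribʳ-* (+ m) (+ suc n)) ⟨
    fromℤ (ℤ.- (+ m ℤ.* + suc n))     ≈⟨ fromℤ-neg (+ m ℤ.* + suc n) ⟩
    -- The call lands in the nonnegative clause, which makes no further call.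
    - fromℤ (+ m ℤ.* + suc n)         ≈⟨ R.-‿cong (fromℤ-+* m (+ suc n)) ⟩
    - (m ×′ 1# * (suc n ×′ 1#))       ≈⟨ -‿distribʳ-* _ _ ⟩
    m ×′ 1# * - (suc n ×′ 1#)         ∎

  fromℤ-* : ∀ i j → fromℤ (i ℤ.* j) ≈ fromℤ i * fromℤ j
  fromℤ-* (+ m)    j = fromℤ-+* m j
  fromℤ-* -[1+ m ] j = begin
    fromℤ (-[1+ m ] ℤ.* j)           ≈⟨ fromℤ-cong (ℤ.neg-distribˡ-* (+ suc m) j) ⟨
    fromℤ (ℤ.- (+ suc m ℤ.* j))      ≈⟨ fromℤ-neg (+ suc m ℤ.* j) ⟩
    - fromℤ (+ suc m ℤ.* j)          ≈⟨ R.-‿cong (fromℤ-+* (suc m) j) ⟩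
    - (suc m ×′ 1# * fromℤ j)        ≈⟨ -‿distribˡ-* _ _ ⟩
    - (suc m ×′ 1#) * fromℤ j        ∎

  fromℤ-homomorphism : ℤ.+-*-rawRing -Raw-AlmostCommutative⟶ fromCommutativeRing R
  fromℤ-homomorphism = record
    { ⟦_⟧    = fromℤ
    ; +-homo = fromℤ-+
    ; *-homo = fromℤ-*
    ; -‿homo = fromℤ-neg
    ; 0-homo = R.refl
    ; 1-homo = R.refl
    }

  -- The equality test on ℤ lets normalisation discard coefficients that cancel to zero.
  open import Algebra.Solver.Ring ℤ.+-*-rawRing (fromCommutativeRing R)
    fromℤ-homomorphism (λ i j → Maybe.map fromℤ-cong (dec⇒maybe (i ℤ.≟ j))) public

module EqualPowerSums {c ℓ} (R : CommutativeRing c ℓ) where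

  open CommutativeRing R using (Carrier; _≈_; rawRing; reflexive)
  open IntegerSolver R
  open Formulas rawRing using (x; y; powerSum)

  -- Reading the formulas in the solver's own syntax reifies them: evaluating
  -- this syntax at n returns the formulas over R definitionally.
  syntaxRawRing : RawRing _ _
  syntaxRawRing = record
    { Carrier = Polynomial 1
    ; _≈_     = _≡_
    ; _+_     = _:+_
    ; _*_     = _:*_
    ; -_      = :-_
    ; 0#      = con (+ 0)
    ; 1#      = con (+ 1)
    }

  module Syntactic = Formulas syntaxRawRing

  xSum ySum : ℕ → Polynomial 1
  xSum r = Syntactic.powerSum r (Syntactic.x (var zero))
  ySum r = Syntactic.powerSum r (Syntactic.y (var zero))

  -- Normal forms are compared before evaluation, so for concrete `p` and `q` the hypothesis is free
  -- of `n` and can be settled by computation.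
  byNormalForm : ∀ (p q : Polynomial 1) → normalise p ≡ normalise q →
                 ∀ n → ⟦ p ⟧ (n ∷ []) ≈ ⟦ q ⟧ (n ∷ [])
  byNormalForm p q eq n =
    prove (n ∷ []) p q (reflexive (cong (λ e → ⟦ e ⟧N (n ∷ [])) eq))

  -- Each family is closed under negation, so for odd `r` both sides vanish; the content lies in `r`
  -- = 2, 4, 6.
  powerSum-x≈y : ∀ n r → 1 ≤ r → r ≤ 7 → powerSum r (x n) ≈ powerSum r (y n)
  powerSum-x≈y n 1 _ _ = byNormalForm (xSum 1) (ySum 1) refl n
  powerSum-x≈y n 2 _ _ = byNormalForm (xSum 2) (ySum 2) refl n
  powerSum-x≈y n 3 _ _ = byNormalForm (xSum 3) (ySum 3) refl n
  powerSum-x≈y n 4 _ _ = byNormalForm (xSum 4) (ySum 4) refl n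
  powerSum-x≈y n 5 _ _ = byNormalForm (xSum 5) (ySum 5) refl n
  powerSum-x≈y n 6 _ _ = byNormalForm (xSum 6) (ySum 6) refl n
  powerSum-x≈y n 7 _ _ = byNormalForm (xSum 7) (ySum 7) refl n
  powerSum-x≈y n (suc (suc (suc (suc (suc (suc (suc (suc _)))))))) _
    (s≤s (s≤s (s≤s (s≤s (s≤s (s≤s (s≤s ())))))))

-- Neither coefficient separates alone: `y₃` also has 16 at n⁴, and its negative has -64 at n³.
LikeX₁ : Poly → Set
LikeX₁ p = coeff p 4 ≡ + 16 ℚ./ 1 × coeff p 3 ≡ ℤ.- (+ 64) ℚ./ 1

likeX₁? : Decidable LikeX₁
likeX₁? p = (coeff p 4 ℚ.≟ _) ×-dec (coeff p 3 ℚ.≟ _)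

LikeX₁-resp : LikeX₁ Respects _≈ᴾ_
LikeX₁-resp p≈q (eq₄ , eq₃) = trans (sym (p≈q 4)) eq₄ , trans (sym (p≈q 3)) eq₃

-- A permutation up to `_≈ᴾ_` preserves the presence of an entry with an `_≈ᴾ_`-invariant property.
-- The first entry `x₁` has it; deciding it on the eight explicit entries of `y` finds none.
x≉y : ¬ (AtIndeterminate.x X ≈ᴹ AtIndeterminate.y X)
x≉y x≈y = from-no (any? likeX₁? (Vector.toList (AtIndeterminate.y X)))
  (Any-resp-↭ (λ {p} {q} → LikeX₁-resp {p} {q}) x≈y (here (refl , refl)))

mainTheorem7 : (∀ (n : ℚ) (r : ℕ) → 1 ≤ r → r ≤ 7 →
    AtRational.powerSum r (AtRational.x n) ≡ AtRational.powerSum r (AtRational.y n))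
    × ¬ (AtIndeterminate.x X ≈ᴹ AtIndeterminate.y X)
-- The raw ring of `ℚ.+-*-commutativeRing` agrees definitionally with the one behind `AtRational`.
mainTheorem7 = EqualPowerSums.powerSum-x≈y ℚ.+-*-commutativeRing , x≉y
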